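{- Let $d, k, i$ be positive integers with $1 \leq i < k$ and $d> \binom{k}{i+1}$. Let $H$ be any $k$-uniform hypergraph with $d_i(H) \geq d$. Then $\mathrm{ex}(n,H)\geq \Omega_k\left( n^{k- 3^k / d}\right)$.
   Context: For a $k$-uniform hypergraph $H$ and $0\le i<k$, the $i$-skeleton $H^{(i)}$ is the $(i+1)$-uniform hypergraph on $V(H)$ whose edges are all $(i+1)$-sets contained in some edge of $H$; the $i$-th skeletal degeneracy $d_i(H)$ is the least $d$ such that every subhypergraph of $H^{(i)}$ has minimum degree at most $d$. $\mathrm{ex}(n,H)$ is the maximum number of edges in an $n$-vertex $k$-uniform hypergraph with no copy of $H$. $\Omega_k(f(n))$ denotes a quantity at least $cf(n)$ for a constant $c>0$ depending only on $k$ (for all sufficiently large $n$). -}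

module Defs where

open import Data.Nat using (ℕ; zero; suc; _≤_)
open import Data.Bool using (Bool; true; false; _∧_; _∨_; not)
open import Data.Fin using (Fin)
open import Data.Fin.Properties using (_≟_)
open import Data.Fin.Subset using (Subset; _∈_; _⊆_; Nonempty; ∣_∣)
open import Data.Vec using (Vec; []; _∷_; lookup; tabulate)
open import Data.List using (List; []; _∷_; _++_; map; length; filter; allFin)
open import Data.Bool.ListAction using (any; all)
open import Data.Product using (Σ; _×_; ∃)
open import Function using (_∘_)
open import Function.Definitions using (Injective)
open import Relation.Binary.PropositionalEquality using (_≡_)
open import Relation.Nullary.Decidable using (⌊_⌋)
open import Relation.Nullary using (¬_)

Hypergraph : ℕ → Set
Hypergraph v = Subset v → Bool

IsEdge : ∀ {v} → Hypergraph v → Subset v → Set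
IsEdge E e = E e ≡ true

Uniform : ∀ {v} → ℕ → Hypergraph v → Set
Uniform k E = ∀ e → IsEdge E e → ∣ e ∣ ≡ k

allSubsets : (v : ℕ) → List (Subset v)
allSubsets zero = [] ∷ []
allSubsets (suc v) = map (true ∷_) (allSubsets v) ++ map (false ∷_) (allSubsets v)

edgeCount : ∀ {v} → Hypergraph v → ℕ
edgeCount {v} E = length (filter (λ e → E e ≡? true) (allSubsets v))
  where
  _≡?_ = Data.Bool._≟_
  open import Data.Bool

subsetB : ∀ {v} → Subset v → Subset v → Bool
subsetB {v} S e = all (λ x → not (lookup S x) ∨ lookup e x) (allFin v)

skeleton : ∀ {v} → ℕ → Hypergraph v → Hypergraph v
skeleton {v} i E S =
  ⌊ ∣ S ∣ Data.Nat.≟ suc i ⌋ ∧ any (λ e → E e ∧ subsetB S e) (allSubsets v)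
  where import Data.Nat

degree : ∀ {v} → Hypergraph v → Fin v → ℕ
degree {v} F w = edgeCount (λ e → F e ∧ lookup e w)

MinDegAllSubAtMost : ∀ {v} → Hypergraph v → ℕ → Set
MinDegAllSubAtMost {v} G d =
  (W : Subset v) (F : Hypergraph v) →
  (∀ e → IsEdge F e → IsEdge G e) →
  (∀ e → IsEdge F e → e ⊆ W) →
  Nonempty W →
  ∃ λ w → w ∈ W × degree F w ≤ d

-- d_i(H) is the least d with MinDegAllSubAtMost (H^(i)) d; hence
-- "d_i(H) ≥ d" means: no d' < d has this property.
SkelDegGE : ∀ {v} → Hypergraph v → ℕ → ℕ → Set
SkelDegGE H i d = ∀ d' → suc d' ≤ d → ¬ MinDegAllSubAtMost (skeleton i H) d'

image : ∀ {v n} → (Fin v → Fin n) → Subset v → Subset n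
image {v} f e = tabulate (λ y → any (λ x → lookup e x ∧ ⌊ f x ≟ y ⌋) (allFin v))

ContainsCopy : ∀ {v n} → Hypergraph n → Hypergraph v → Set
ContainsCopy {v} {n} G H =
  Σ (Fin v → Fin n) λ f → Injective _≡_ _≡_ f ×
    (∀ e → IsEdge H e → IsEdge G (image f e))

ExAtLeast : ∀ {v} → ℕ → (n : ℕ) → Hypergraph v → ℕ → Set
ExAtLeast k n H m =
  Σ (Hypergraph n) λ G → Uniform k G × ¬ ContainsCopy G H × m ≤ edgeCount G

-- The i-skeleton of H contains a subhypergraph F on a set W of w vertices with all degrees ≥ d,
-- so with a = i + 1 and c = k C a it has e ≥ d w / a edges, and w > k because d > c.
-- In a random a-uniform hypergraph on n vertices with edge probability 1/q, the expected number of
-- copies of F is at most n^w / q^e, while the expected number of k-cliques is (n C k) / q^c.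
-- For q ≈ n^(3^k / (c d)) the former, even multiplied by n C k, is negligible against the latter, since
-- a c = (k − i) (k C i) and (k + 1) (k C i) ≤ 3^k. Hence some outcome has no copy of F and at least
-- half the expected number of k-cliques; these cliques form the edges of a hypergraph without a copy of H.
module Submission where

open import Defs
open import Data.Nat using (ℕ; zero; suc; _+_; _*_; _^_; _∸_; _!; _≤_; _<_; _≤′_; ≤′-reflexive; ≤′-step; _≤ᵇ_; _≡ᵇ_; _<?_; _≤?_; z≤n; s≤s; z<s; NonZero; >-nonZero)
import Data.Nat
open import Data.Nat.Properties hiding (_≟_)
open import Data.Nat.Combinatorics using (_C_; nCk≡nC[n∸k]; nCn≡1; nC1≡n; nCk+nC[k+1]≡[n+1]C[k+1])
open import Data.Nat.Tactic.RingSolver using (solve-∀)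
open import Data.Bool using (Bool; true; false; T; _∧_; _∨_; not)
import Data.Bool as Bool
import Data.Bool.Properties as Bool
open import Data.Bool.ListAction using (any)
open import Data.Fin using (Fin; zero; suc)
import Data.Fin.Properties as Fin
open import Data.Fin.Subset using (Subset; _∈_; Nonempty; ∣_∣)
open import Data.Fin.Subset.Properties using (anySubset?; _∈?_; nonempty?)
open import Data.Vec using (Vec; []; _∷_; lookup)
import Data.Vec.Properties as Vec
open import Data.List using (List; []; _∷_; _++_; map; length; filter; allFin; cartesianProductWith)
import Data.List.Properties as List
open import Data.List.Relation.Unary.Any using (here; there)
open import Data.List.Membership.Propositional using (lose) renaming (_∈_ to _∈ˡ_)
open import Data.List.Membership.Propositional.Properties using (∈-allFin; ∈-++⁺ˡ; ∈-++⁺ʳ; ∈-map⁺; ∈-cartesianProductWith⁺)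
open import Data.List.Relation.Unary.Any.Properties using (any⁺)
open import Data.List.Relation.Unary.All as All using ()
open import Data.List.Relation.Unary.All.Properties using (all⁺)
open import Data.Product using (∃; Σ; _×_; _,_; proj₁; proj₂)
open import Function using (_∘_; id)
open import Function.Bundles using (Equivalence)
open import Function.Definitions using (Injective)
open import Relation.Binary.Definitions using (DecidableEquality)
open import Relation.Binary.PropositionalEquality
open import Relation.Nullary using (¬_; Dec; yes; no; contradiction)
open import Relation.Nullary.Decidable using (⌊_⌋; isYes≗does; toWitness; _×-dec_; _→-dec_)

private
  variable
    A B : Set

-- Binomial coefficients and powers

nC0≡1 : ∀ n → n C 0 ≡ 1
nC0≡1 n = trans (nCk≡nC[n∸k] {k = 0} {n = n} z≤n) (nCn≡1 n)

-- (k + 1) (n C (k + 1)) = (n − k) (n C k), with both sides moved so that no subtraction occurs.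
C-absorption : ∀ n k → suc k * (n C suc k) + k * (n C k) ≡ n * (n C k)
C-absorption zero zero = refl
C-absorption zero (suc k) = cong₂ _+_ (*-zeroʳ (2 + k)) (*-zeroʳ (suc k))
C-absorption (suc n) zero = trans (cong (λ z → 1 * z + 0) (nC1≡n (suc n)))
  (trans (lem n) (cong (suc n *_) (sym (nC0≡1 (suc n)))))
  where
  lem : ∀ n → 1 * suc n + 0 ≡ suc n * 1
  lem = solve-∀
C-absorption (suc n) (suc j) = begin
  suc (suc j) * (suc n C suc (suc j)) + suc j * (suc n C suc j)
    ≡⟨ cong₂ (λ x y → suc (suc j) * x + suc j * y) (nCk+nC[k+1]≡[n+1]C[k+1] n (suc j)) (nCk+nC[k+1]≡[n+1]C[k+1] n j) ⟨
  suc (suc j) * (b + c) + suc j * (a + b)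
    ≡⟨ regroup j a b c ⟩
  (suc (suc j) * c + suc j * b) + (suc j * b + j * a) + (a + b)
    ≡⟨ cong₂ (λ x y → x + y + (a + b)) (C-absorption n (suc j)) (C-absorption n j) ⟩
  n * b + n * a + (a + b)
    ≡⟨ collect n a b ⟩
  suc n * (a + b)
    ≡⟨ cong (suc n *_) (nCk+nC[k+1]≡[n+1]C[k+1] n j) ⟩
  suc n * (suc n C suc j) ∎
  where
  open ≡-Reasoning
  a = n C j
  b = n C suc j
  c = n C suc (suc j)
  regroup : ∀ j a b c → suc (suc j) * (b + c) + suc j * (a + b)
    ≡ (suc (suc j) * c + suc j * b) + (suc j * b + j * a) + (a + b)
  regroup = solve-∀
  collect : ∀ n a b → n * b + n * a + (a + b) ≡ suc n * (a + b)
  collect = solve-∀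

[1+k][1+n]C[1+k]≡[1+n]nCk : ∀ n k → suc k * (suc n C suc k) ≡ suc n * (n C k)
[1+k][1+n]C[1+k]≡[1+n]nCk n k = begin
  suc k * (suc n C suc k)                     ≡⟨ cong (suc k *_) (nCk+nC[k+1]≡[n+1]C[k+1] n k) ⟨
  suc k * (n C k + n C suc k)                 ≡⟨ lem k (n C k) (n C suc k) ⟩
  n C k + (suc k * (n C suc k) + k * (n C k)) ≡⟨ cong (n C k +_) (C-absorption n k) ⟩
  suc n * (n C k)                             ∎
  where
  open ≡-Reasoning
  lem : ∀ k x y → suc k * (x + y) ≡ x + (suc k * y + k * x)
  lem = solve-∀

-- The right side is the product of the `k` factors from `x + 1` to `x + k`.
x^k≤k!*[k+x]Ck : ∀ x k → x ^ k ≤ k ! * ((k + x) C k)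
x^k≤k!*[k+x]Ck x zero = ≤-reflexive (sym (trans (+-identityʳ _) (nC0≡1 x)))
x^k≤k!*[k+x]Ck x (suc k) = begin
  x * x ^ k                              ≤⟨ *-mono-≤ (m≤n+m x (suc k)) (x^k≤k!*[k+x]Ck x k) ⟩
  (suc k + x) * (k ! * ((k + x) C k))    ≡⟨ swap (suc k + x) (k !) _ ⟩
  k ! * ((suc k + x) * ((k + x) C k))    ≡⟨ cong (k ! *_) ([1+k][1+n]C[1+k]≡[1+n]nCk (k + x) k) ⟨
  k ! * (suc k * ((suc k + x) C suc k))  ≡⟨ swap′ (k !) (suc k) _ ⟩
  suc k ! * ((suc k + x) C suc k)        ∎
  where
  open ≤-Reasoning
  swap : ∀ a b c → a * (b * c) ≡ b * (a * c)
  swap = solve-∀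
  swap′ : ∀ a b c → a * (b * c) ≡ (b * a) * c
  swap′ = solve-∀

C-monoˡ : ∀ {m n} k → m ≤ n → m C k ≤ n C k
C-monoˡ k m≤n = go (≤⇒≤′ m≤n)
  where
  step : ∀ n k → n C k ≤ suc n C k
  step n zero = ≤-reflexive (trans (nC0≡1 n) (sym (nC0≡1 (suc n))))
  step n (suc k) = ≤-trans (m≤n+m _ (n C k)) (≤-reflexive (nCk+nC[k+1]≡[n+1]C[k+1] n k))
  go : ∀ {m n} → m ≤′ n → m C k ≤ n C k
  go (≤′-reflexive refl) = ≤-refl
  go (≤′-step p) = ≤-trans (go p) (step _ k)

C>0 : ∀ {n k} → k ≤ n → 0 < n C k
C>0 {n} {k} k≤n = subst (_≤ n C k) (nCn≡1 k) (C-monoˡ k k≤n)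

-- The main case follows Pascal's rule: from row `k + 1` to row `k + 2` the two terms cost a factor
-- 2 and the prefactor grows from `k + 2` to `k + 3`, while `2 (k + 3) ≤ 3 (k + 2)`. From row 0 to
-- row 1 the same step would cost a factor 4, so row 1 is checked directly.
[1+k]*kCi≤3^k : ∀ k i → suc k * (k C i) ≤ 3 ^ k
[1+k]*kCi≤3^k zero zero = ≤-refl
[1+k]*kCi≤3^k zero (suc i) = z≤n
[1+k]*kCi≤3^k (suc zero) zero = s≤s (s≤s z≤n)
[1+k]*kCi≤3^k (suc zero) (suc zero) = s≤s (s≤s z≤n)
[1+k]*kCi≤3^k (suc zero) (suc (suc i)) = z≤n
[1+k]*kCi≤3^k (suc (suc k)) zero = begin
  (3 + k) * ((2 + k) C 0)   ≡⟨ cong ((3 + k) *_) (trans (nC0≡1 (2 + k)) (sym (nC0≡1 (1 + k)))) ⟩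
  (3 + k) * ((1 + k) C 0)   ≤⟨ *-monoˡ-≤ ((1 + k) C 0) (≤-trans (m≤m+n (3 + k) (k + (k + 3))) (≤-reflexive (lem k))) ⟩
  (3 * (2 + k)) * ((1 + k) C 0)   ≡⟨ *-assoc 3 (2 + k) ((1 + k) C 0) ⟩
  3 * ((2 + k) * ((1 + k) C 0))   ≤⟨ *-monoʳ-≤ 3 ([1+k]*kCi≤3^k (suc k) zero) ⟩
  3 ^ (2 + k) ∎
  where
  open ≤-Reasoning
  lem : ∀ k → 3 + k + (k + (k + 3)) ≡ 3 * (2 + k)
  lem = solve-∀
[1+k]*kCi≤3^k (suc (suc k)) (suc i) = *-cancelˡ-≤ (2 + k) (begin
  (2 + k) * ((3 + k) * ((2 + k) C suc i))
    ≡⟨ cong (λ z → (2 + k) * ((3 + k) * z)) (nCk+nC[k+1]≡[n+1]C[k+1] (suc k) i) ⟨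
  (2 + k) * ((3 + k) * (a + b))
    ≡⟨ lem k a b ⟩
  (3 + k) * ((2 + k) * a + (2 + k) * b)
    ≤⟨ *-monoʳ-≤ (3 + k) (+-mono-≤ ([1+k]*kCi≤3^k (suc k) i) ([1+k]*kCi≤3^k (suc k) (suc i))) ⟩
  (3 + k) * (t + t)
    ≤⟨ m≤m+n _ (k * t) ⟩
  (3 + k) * (t + t) + k * t
    ≡⟨ lem′ k t ⟩
  (2 + k) * (3 * t) ∎)
  where
  open ≤-Reasoning
  a = suc k C i
  b = suc k C suc i
  t = 3 ^ suc k
  lem : ∀ k a b → (2 + k) * ((3 + k) * (a + b)) ≡ (3 + k) * ((2 + k) * a + (2 + k) * b)
  lem = solve-∀
  lem′ : ∀ k t → (3 + k) * (t + t) + k * t ≡ (2 + k) * (3 * t)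
  lem′ = solve-∀

^-*-distrib : ∀ m n o → (m * n) ^ o ≡ m ^ o * n ^ o
^-*-distrib m n zero = refl
^-*-distrib m n (suc o) = trans (cong (m * n *_) (^-*-distrib m n o)) (lem m n (m ^ o) (n ^ o))
  where
  lem : ∀ a b c d → a * b * (c * d) ≡ a * c * (b * d)
  lem = solve-∀

-- Induction on `x` raises the base only when forced, and `q + 1 ≤ 2 q` bounds the overshoot. The
-- form `suc ρ` anticipates the edge probability `1 / (1 + ρ)`.
ceil-root : ∀ r .{{_ : NonZero r}} x → 1 ≤ x → ∃ λ ρ → x ≤ suc ρ ^ r × suc ρ ^ r ≤ 2 ^ r * x
ceil-root r (suc zero) _ = 0 , ≤-reflexive (sym (^-zeroˡ r))
  , ≤-trans (≤-reflexive (^-zeroˡ r)) (≤-trans (m^n>0 2 r) (≤-reflexive (sym (*-identityʳ _))))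
ceil-root r (suc x@(suc _)) _ with ceil-root r x z<s
... | ρ , x≤ , ≤x with suc x ≤? suc ρ ^ r
...   | yes x<q^r = ρ , x<q^r , ≤-trans ≤x (*-monoʳ-≤ (2 ^ r) (n≤1+n x))
...   | no x≮q^r = suc ρ , <-≤-trans (s≤s x≤) (^-monoˡ-< r (n<1+n (suc ρ))) , (begin
  suc (suc ρ) ^ r       ≤⟨ ^-monoˡ-≤ r (+-monoˡ-≤ (suc ρ) (s≤s (z≤n {ρ}))) ⟩
  (suc ρ + suc ρ) ^ r   ≡⟨ cong (λ z → (suc ρ + z) ^ r) (+-identityʳ (suc ρ)) ⟨
  (2 * suc ρ) ^ r       ≡⟨ ^-*-distrib 2 (suc ρ) r ⟩
  2 ^ r * suc ρ ^ r     ≤⟨ *-monoʳ-≤ (2 ^ r) (m≤n⇒m≤1+n (≮⇒≥ x≮q^r)) ⟩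
  2 ^ r * suc x         ∎)
  where open ≤-Reasoning

-- Here `w` and `k C suc i + s` stand for the numbers of vertices and edges of the dense
-- subhypergraph, so `s` is its surplus over the faces of a `k`-clique. For `q` about
-- `n^(3^k / (c d))` the conclusion says that `n ^ w` has smaller order than `q ^ s`.
exponent-gap : ∀ k i d w s → suc i ≤ k → suc k ≤ w → k C suc i < d →
  d * w ≤ suc i * (k C suc i + s) → w * ((k C suc i) * d) < 3 ^ k * s
exponent-gap k i (suc d) w s i<k k<w (s≤s c≤d) dw≤ with m≤n⇒∃[o]m+o≡n i<k
... | t , refl with m≤n⇒∃[o]m+o≡n (≤-trans i<k (<⇒≤ k<w))
...   | u , refl = *-cancelˡ-< (suc i) _ _ (begin-strict
  a * (w * (c * suc d))        ≡⟨ lem₁ a w c (suc d) ⟩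
  w * (a * c) * suc d          ≡⟨ cong (λ z → w * z * suc d) ac≡ ⟩
  w * (suc t * b) * suc d      ≡⟨ lem₂ w t b (suc d) ⟩
  w * suc t * (b * suc d)      ≤⟨ *-monoˡ-≤ (b * suc d) w[1+t]≤ ⟩
  u * suc k * (b * suc d)      ≡⟨ lem₃ u (suc k) b (suc d) ⟩
  suc k * b * (suc d * u)      ≤⟨ *-monoˡ-≤ (suc d * u) ([1+k]*kCi≤3^k k i) ⟩
  3 ^ k * (suc d * u)          <⟨ *-monoʳ-< (3 ^ k) {{m^n≢0 3 k}} (s≤s (m≤n+m (suc d * u) i)) ⟩
  3 ^ k * (a + suc d * u)      ≤⟨ *-monoʳ-≤ (3 ^ k) a+du≤as ⟩
  3 ^ k * (a * s)              ≡⟨ lem₄ (3 ^ k) a s ⟩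
  a * (3 ^ k * s)              ∎)
  where
  open ≤-Reasoning
  a = suc i
  c = k C a
  b = k C i
  lem₁ : ∀ a w c d → a * (w * (c * d)) ≡ w * (a * c) * d
  lem₁ = solve-∀
  lem₂ : ∀ w t b d → w * (suc t * b) * d ≡ w * suc t * (b * d)
  lem₂ = solve-∀
  lem₃ : ∀ u k b d → u * k * (b * d) ≡ k * b * (d * u)
  lem₃ = solve-∀
  lem₄ : ∀ x a s → x * (a * s) ≡ a * (x * s)
  lem₄ = solve-∀
  lem₅ : ∀ i t b → (suc i + t) * b ≡ suc t * b + i * b
  lem₅ = solve-∀
  lem₆ : ∀ i t u → (suc i + u) * suc t + (u * suc i) ≡ u * suc (suc i + t) + suc i * suc t
  lem₆ = solve-∀
  lem₇ : ∀ a d u → a + suc d * u + a * d ≡ suc d * (a + u)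
  lem₇ = solve-∀
  ac≡ : a * c ≡ suc t * b
  ac≡ = +-cancelʳ-≡ (i * b) _ _ (trans (C-absorption k i) (lem₅ i t b))
  t<u : suc t ≤ u
  t<u = +-cancelˡ-≤ a _ _ (≤-trans (≤-reflexive (+-suc a t)) k<w)
  -- With `suc t = k − i` and `u = w − a` this reads `w (k − i) ≤ (w − a) (k + 1)`, an equality at
  -- `w = k + 1`.
  w[1+t]≤ : w * suc t ≤ u * suc k
  w[1+t]≤ = +-cancelʳ-≤ (a * suc t) _ _ (begin
    w * suc t + a * suc t  ≤⟨ +-monoʳ-≤ (w * suc t) (*-monoʳ-≤ a t<u) ⟩
    w * suc t + a * u      ≡⟨ cong (w * suc t +_) (*-comm a u) ⟩
    w * suc t + u * a      ≡⟨ lem₆ i t u ⟩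
    u * suc k + a * suc t  ∎)
  -- After the match `suc d` is the given degree bound, so `c ≤ d` leaves a surplus of `a`. This
  -- surplus makes the chain above strict.
  a+du≤as : a + suc d * u ≤ a * s
  a+du≤as = +-cancelʳ-≤ (a * d) _ _ (begin
    a + suc d * u + a * d  ≡⟨ lem₇ a d u ⟩
    suc d * w              ≤⟨ dw≤ ⟩
    a * (c + s)            ≡⟨ trans (*-distribˡ-+ a c s) (+-comm (a * c) (a * s)) ⟩
    a * s + a * c          ≤⟨ +-monoʳ-≤ (a * s) (*-monoʳ-≤ a c≤d) ⟩
    a * s + a * d          ∎)

-- Compare `r`-th powers. The strict inequality `w * r < x * s` between integers leaves a whole
-- factor `n`, which outweighs the `2 ^ r` produced by the factor 2.
few-copies : ∀ {n q r x w s} → n ^ x ≤ q ^ r → 2 ^ r < n → w * r < x * s → 2 * n ^ w < q ^ s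
few-copies {n} {q} {r} {x} {w} {s} n^x≤q^r 2^r<n wr<xs = ≰⇒> λ q^s≤2n^w →
  <-irrefl refl (begin-strict
    n ^ (x * s)               ≡⟨ ^-*-assoc n x s ⟨
    (n ^ x) ^ s               ≤⟨ ^-monoˡ-≤ s n^x≤q^r ⟩
    (q ^ r) ^ s               ≡⟨ trans (^-*-assoc q r s) (trans (cong (q ^_) (*-comm r s)) (sym (^-*-assoc q s r))) ⟩
    (q ^ s) ^ r               ≤⟨ ^-monoˡ-≤ r q^s≤2n^w ⟩
    (2 * n ^ w) ^ r           ≡⟨ ^-*-distrib 2 (n ^ w) r ⟩
    2 ^ r * (n ^ w) ^ r       ≡⟨ cong (2 ^ r *_) (^-*-assoc n w r) ⟩
    2 ^ r * n ^ (w * r)       <⟨ *-monoˡ-< (n ^ (w * r)) {{m^n≢0 n (w * r)}} 2^r<n ⟩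
    n ^ suc (w * r)           ≤⟨ ^-monoʳ-≤ n wr<xs ⟩
    n ^ (x * s)               ∎)
  where
  open ≤-Reasoning
  instance
    n≢0 : NonZero n
    n≢0 = >-nonZero (≤-<-trans z≤n 2^r<n)

-- Since `n ≤ 2 (n − k)`, replacing `n` by `n − k` loses only `2 ^ k`.
n^k≤2^k*k!*nCk : ∀ {n k} → k + k ≤ n → n ^ k ≤ 2 ^ k * k ! * (n C k)
n^k≤2^k*k!*nCk {n} {k} 2k≤n with m≤n⇒∃[o]m+o≡n (≤-trans (m≤m+n k k) 2k≤n)
... | x , refl = begin
  (k + x) ^ k                      ≤⟨ ^-monoˡ-≤ k (+-monoˡ-≤ x (+-cancelˡ-≤ k _ _ 2k≤n)) ⟩
  (x + x) ^ k                      ≡⟨ cong (λ z → (x + z) ^ k) (+-identityʳ x) ⟨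
  (2 * x) ^ k                      ≡⟨ ^-*-distrib 2 x k ⟩
  2 ^ k * x ^ k                    ≤⟨ *-monoʳ-≤ (2 ^ k) (x^k≤k!*[k+x]Ck x k) ⟩
  2 ^ k * (k ! * ((k + x) C k))    ≡⟨ *-assoc (2 ^ k) _ _ ⟨
  2 ^ k * k ! * ((k + x) C k)      ∎
  where open ≤-Reasoning

-- `T` will be the number of `k`-sets and `m` the number of cliques; the `d`-th power clears the
-- fractional exponent. The rounding loss `2 ^ (c * d)` enters the `d`-th power as `2 ^ c` and is
-- enlarged to `2 ^ x`, which for `x = 3 ^ k` depends on `k` alone.
many-edges : ∀ {n k c d q K T m x} → n ^ k ≤ K * T → T ≤ 2 * q ^ c * m →
  q ^ (c * d) ≤ 2 ^ (c * d) * n ^ x → c ≤ x → n ^ (k * d) ≤ (K * 2 * 2 ^ x * m) ^ d * n ^ x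
many-edges {n} {k} {c} {d} {q} {K} {T} {m} {x} n^k≤ T≤ q≤ c≤x = begin
  n ^ (k * d)                                   ≡⟨ ^-*-assoc n k d ⟨
  (n ^ k) ^ d                                   ≤⟨ ^-monoˡ-≤ d (≤-trans n^k≤ (*-monoʳ-≤ K T≤)) ⟩
  (K * (2 * q ^ c * m)) ^ d                     ≡⟨ cong (_^ d) (lem₁ K (q ^ c) m) ⟩
  (K * 2 * m * q ^ c) ^ d                       ≡⟨ ^-*-distrib (K * 2 * m) (q ^ c) d ⟩
  (K * 2 * m) ^ d * (q ^ c) ^ d                 ≡⟨ cong ((K * 2 * m) ^ d *_) (^-*-assoc q c d) ⟩
  (K * 2 * m) ^ d * q ^ (c * d)                 ≤⟨ *-monoʳ-≤ ((K * 2 * m) ^ d) q≤ ⟩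
  (K * 2 * m) ^ d * (2 ^ (c * d) * n ^ x)       ≡⟨ *-assoc ((K * 2 * m) ^ d) _ _ ⟨
  (K * 2 * m) ^ d * 2 ^ (c * d) * n ^ x         ≡⟨ cong (λ z → (K * 2 * m) ^ d * z * n ^ x) (^-*-assoc 2 c d) ⟨
  (K * 2 * m) ^ d * (2 ^ c) ^ d * n ^ x         ≡⟨ cong (_* n ^ x) (^-*-distrib (K * 2 * m) (2 ^ c) d) ⟨
  (K * 2 * m * 2 ^ c) ^ d * n ^ x               ≤⟨ *-monoˡ-≤ (n ^ x) (^-monoˡ-≤ d (*-monoʳ-≤ (K * 2 * m) (^-monoʳ-≤ 2 c≤x))) ⟩
  (K * 2 * m * 2 ^ x) ^ d * n ^ x               ≡⟨ cong (λ z → z ^ d * n ^ x) (lem₂ (K * 2) m (2 ^ x)) ⟩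
  (K * 2 * 2 ^ x * m) ^ d * n ^ x               ∎
  where
  open ≤-Reasoning
  lem₁ : ∀ K y m → K * (2 * y * m) ≡ K * 2 * m * y
  lem₁ = solve-∀
  lem₂ : ∀ K m y → K * m * y ≡ K * y * m
  lem₂ = solve-∀

-- Booleans and indicators

∧-true : ∀ {a b} → a ∧ b ≡ true → a ≡ true × b ≡ true
∧-true {true} {true} _ = refl , refl

≡true⇒T : ∀ {b} → b ≡ true → T b
≡true⇒T = Equivalence.from Bool.T-≡

T⇒≡true : ∀ {b} → T b → b ≡ true
T⇒≡true = Equivalence.to Bool.T-≡

⌊⌋-true⁻ : {P : Set} {P? : Dec P} → ⌊ P? ⌋ ≡ true → P
⌊⌋-true⁻ = toWitness ∘ ≡true⇒T

⌊⌋-true⁺ : {P : Set} (P? : Dec P) → P → ⌊ P? ⌋ ≡ true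
⌊⌋-true⁺ (yes _) _ = refl
⌊⌋-true⁺ (no ¬p) p = contradiction p ¬p

𝟙 : Bool → ℕ
𝟙 true  = 1
𝟙 false = 0

𝟙-∧ : ∀ a b → 𝟙 (a ∧ b) ≡ 𝟙 a * 𝟙 b
𝟙-∧ true  b = sym (+-identityʳ (𝟙 b))
𝟙-∧ false b = refl

𝟙-mono : ∀ {a b} → (a ≡ true → b ≡ true) → 𝟙 a ≤ 𝟙 b
𝟙-mono {false} _ = z≤n
𝟙-mono {true} a⇒b rewrite a⇒b refl = ≤-refl

𝟙-cong : ∀ {a b} → (a ≡ true → b ≡ true) → (b ≡ true → a ≡ true) → 𝟙 a ≡ 𝟙 b
𝟙-cong a⇒b b⇒a = ≤-antisym (𝟙-mono a⇒b) (𝟙-mono b⇒a)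

-- Finite sums

∑ : List A → (A → ℕ) → ℕ
∑ []       f = 0
∑ (x ∷ xs) f = f x + ∑ xs f

∑-cong : ∀ (xs : List A) {f g} → (∀ x → f x ≡ g x) → ∑ xs f ≡ ∑ xs g
∑-cong []       f≗g = refl
∑-cong (x ∷ xs) f≗g = cong₂ _+_ (f≗g x) (∑-cong xs f≗g)

∑-mono : ∀ (xs : List A) {f g} → (∀ x → f x ≤ g x) → ∑ xs f ≤ ∑ xs g
∑-mono []       f≤g = z≤n
∑-mono (x ∷ xs) f≤g = +-mono-≤ (f≤g x) (∑-mono xs f≤g)

∑-+ : ∀ (xs : List A) f g → ∑ xs (λ x → f x + g x) ≡ ∑ xs f + ∑ xs g
∑-+ []       f g = refl
∑-+ (x ∷ xs) f g = trans (cong (f x + g x +_) (∑-+ xs f g)) (lem (f x) (g x) (∑ xs f) (∑ xs g))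
  where
  lem : ∀ a b c d → a + b + (c + d) ≡ a + c + (b + d)
  lem = solve-∀

∑-*ʳ : ∀ (xs : List A) f c → ∑ xs (λ x → f x * c) ≡ ∑ xs f * c
∑-*ʳ []       f c = refl
∑-*ʳ (x ∷ xs) f c = trans (cong (f x * c +_) (∑-*ʳ xs f c)) (sym (*-distribʳ-+ c (f x) (∑ xs f)))

∑-const : ∀ (xs : List A) c → ∑ xs (λ _ → c) ≡ length xs * c
∑-const []       c = refl
∑-const (x ∷ xs) c = cong (c +_) (∑-const xs c)

∑-0 : ∀ (xs : List A) {f} → (∀ x → f x ≡ 0) → ∑ xs f ≡ 0
∑-0 xs f≗0 = trans (∑-cong xs f≗0) (trans (∑-const xs 0) (*-zeroʳ (length xs)))

∑-++ : ∀ (xs ys : List A) f → ∑ (xs ++ ys) f ≡ ∑ xs f + ∑ ys f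
∑-++ []       ys f = refl
∑-++ (x ∷ xs) ys f = trans (cong (f x +_) (∑-++ xs ys f)) (sym (+-assoc (f x) _ _))

∑-map : ∀ (g : A → B) xs f → ∑ (map g xs) f ≡ ∑ xs (f ∘ g)
∑-map g []       f = refl
∑-map g (x ∷ xs) f = cong (f (g x) +_) (∑-map g xs f)

∑-swap : ∀ (xs : List A) (ys : List B) (f : A → B → ℕ) →
  ∑ xs (λ x → ∑ ys (f x)) ≡ ∑ ys (λ y → ∑ xs (λ x → f x y))
∑-swap []       ys f = sym (∑-0 ys (λ _ → refl))
∑-swap (x ∷ xs) ys f = trans (cong (∑ ys (f x) +_) (∑-swap xs ys f))
  (sym (∑-+ ys (f x) (λ y → ∑ xs (λ x → f x y))))

≤∑ : ∀ {xs : List A} {x} f → x ∈ˡ xs → f x ≤ ∑ xs f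
≤∑ f (here refl) = m≤m+n _ _
≤∑ f (there x∈)  = ≤-trans (≤∑ f x∈) (m≤n+m _ _)

∑-allFin : ∀ v (f : Fin (suc v) → ℕ) → ∑ (allFin (suc v)) f ≡ f zero + ∑ (allFin v) (f ∘ suc)
∑-allFin v f = cong (f zero +_)
  (trans (cong (λ xs → ∑ xs f) (sym (List.map-tabulate id suc))) (∑-map suc (allFin v) f))

∑-allSubsets : ∀ v f → ∑ (allSubsets (suc v)) f
  ≡ ∑ (allSubsets v) (f ∘ (true ∷_)) + ∑ (allSubsets v) (f ∘ (false ∷_))
∑-allSubsets v f = trans (∑-++ (map (true ∷_) (allSubsets v)) _ f)
  (cong₂ _+_ (∑-map (true ∷_) (allSubsets v) f) (∑-map (false ∷_) (allSubsets v) f))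

length-filter-true : ∀ (E : A → Bool) xs → length (filter (λ e → E e Bool.≟ true) xs) ≡ ∑ xs (𝟙 ∘ E)
length-filter-true E [] = refl
length-filter-true E (x ∷ xs) with E x
... | true  = cong suc (length-filter-true E xs)
... | false = length-filter-true E xs

size : ∀ {v} → Hypergraph v → ℕ
size {v} E = ∑ (allSubsets v) (𝟙 ∘ E)

edgeCount≡size : ∀ {v} (E : Hypergraph v) → edgeCount E ≡ size E
edgeCount≡size {v} E = length-filter-true E (allSubsets v)

∣S∣≡∑ : ∀ {v} (S : Subset v) → ∣ S ∣ ≡ ∑ (allFin v) (𝟙 ∘ lookup S)
∣S∣≡∑ [] = refl
∣S∣≡∑ {suc v} (true  ∷ S) = trans (cong suc (∣S∣≡∑ S)) (sym (∑-allFin v (𝟙 ∘ lookup (true ∷ S))))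
∣S∣≡∑ {suc v} (false ∷ S) = trans (∣S∣≡∑ S) (sym (∑-allFin v (𝟙 ∘ lookup (false ∷ S))))

∈-allSubsets : ∀ {v} (S : Subset v) → S ∈ˡ allSubsets v
∈-allSubsets [] = here refl
∈-allSubsets (true  ∷ S) = ∈-++⁺ˡ (∈-map⁺ _ (∈-allSubsets S))
∈-allSubsets (false ∷ S) = ∈-++⁺ʳ _ (∈-map⁺ _ (∈-allSubsets S))

any-true⁺ : ∀ (p : A → Bool) {x xs} → x ∈ˡ xs → p x ≡ true → any p xs ≡ true
any-true⁺ p x∈ px = T⇒≡true (any⁺ p (lose x∈ (≡true⇒T px)))

any-true⁻ : ∀ (p : A → Bool) xs → any p xs ≡ true → ∃ λ x → p x ≡ true
any-true⁻ p (x ∷ xs) eq with p x in px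
... | true  = x , px
... | false = any-true⁻ p xs eq

any-false : ∀ (p : A → Bool) xs → any p xs ≡ false → ∑ xs (𝟙 ∘ p) ≡ 0
any-false p [] _ = refl
any-false p (x ∷ xs) eq with p x
... | false = any-false p xs eq

subsetB⇒⊆ : ∀ {v} (S e : Subset v) → subsetB S e ≡ true → ∀ x → lookup S x ≡ true → lookup e x ≡ true
subsetB⇒⊆ S e S⊆e x Sx with All.lookup (all⁺ _ (allFin _) (≡true⇒T S⊆e)) (∈-allFin x)
... | p rewrite Sx = T⇒≡true p

-- Images of sets under maps that are injective on them

_≟ˢ_ : ∀ {v} → DecidableEquality (Subset v)
_≟ˢ_ = Vec.≡-dec Bool._≟_

module _ (_≟_ : DecidableEquality A) where

  -- Completeness and absence of repetitions in one equation, in the form that double counts use.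
  Enumerates : List A → Set
  Enumerates xs = ∀ a → ∑ xs (λ x → 𝟙 ⌊ a ≟ x ⌋) ≡ 1

  ∑-unique : ∀ xs → Enumerates xs → (p : A → Bool) →
    (∀ x y → p x ≡ true → p y ≡ true → x ≡ y) → ∑ xs (𝟙 ∘ p) ≡ 𝟙 (any p xs)
  ∑-unique xs enum p unique with any p xs in eq
  ... | false = any-false p xs eq
  ... | true with any-true⁻ p xs eq
  ...   | a , pa = trans (∑-cong xs λ x → 𝟙-cong
            (λ px → ⌊⌋-true⁺ (a ≟ x) (unique a x pa px))
            (λ a≡x → subst (λ z → p z ≡ true) (⌊⌋-true⁻ a≡x) pa))
            (enum a)

enumerates-allFin : ∀ v → Enumerates Fin._≟_ (allFin v)
enumerates-allFin (suc v) zero = trans (∑-allFin v λ x → 𝟙 ⌊ zero Fin.≟ x ⌋) (cong suc (∑-0 (allFin v) λ _ → refl))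
enumerates-allFin (suc v) (suc a) = trans (∑-allFin v λ x → 𝟙 ⌊ suc a Fin.≟ x ⌋) (trans
  (∑-cong (allFin v) λ x → cong 𝟙 (trans (isYes≗does (suc a Fin.≟ suc x)) (sym (isYes≗does (a Fin.≟ x)))))
  (enumerates-allFin v a))

enumerates-allSubsets : ∀ v → Enumerates _≟ˢ_ (allSubsets v)
enumerates-allSubsets zero [] = refl
enumerates-allSubsets (suc v) (true ∷ S) = trans (∑-allSubsets v _) (cong₂ _+_
  (trans (∑-cong (allSubsets v) λ S′ → cong 𝟙 (trans (isYes≗does ((true ∷ S) ≟ˢ (true ∷ S′))) (sym (isYes≗does (S ≟ˢ S′)))))
    (enumerates-allSubsets v S))
  (∑-0 (allSubsets v) λ S′ → cong 𝟙 (isYes≗does ((true ∷ S) ≟ˢ (false ∷ S′)))))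
enumerates-allSubsets (suc v) (false ∷ S) = trans (∑-allSubsets v _) (cong₂ _+_
  (∑-0 (allSubsets v) λ S′ → cong 𝟙 (isYes≗does ((false ∷ S) ≟ˢ (true ∷ S′))))
  (trans (∑-cong (allSubsets v) λ S′ → cong 𝟙 (trans (isYes≗does ((false ∷ S) ≟ˢ (false ∷ S′))) (sym (isYes≗does (S ≟ˢ S′)))))
    (enumerates-allSubsets v S)))

module _ (_≟ᴬ_ : DecidableEquality A) (_≟ᴮ_ : DecidableEquality B)
         (xs : List A) (ys : List B) (enumᴬ : Enumerates _≟ᴬ_ xs) (enumᴮ : Enumerates _≟ᴮ_ ys) where

  -- Double count of the pairs with `p x` and `φ x = y`: injectivity leaves each `y` at most one
  -- partner, and each `x` has exactly one.
  ∑-image : ∀ (φ : A → B) (p : A → Bool) →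
    (∀ x y → p x ≡ true → p y ≡ true → φ x ≡ φ y → x ≡ y) →
    ∑ ys (λ y → 𝟙 (any (λ x → p x ∧ ⌊ φ x ≟ᴮ y ⌋) xs)) ≡ ∑ xs (𝟙 ∘ p)
  ∑-image φ p inj = begin
    ∑ ys (λ y → 𝟙 (any (λ x → p x ∧ ⌊ φ x ≟ᴮ y ⌋) xs))
      ≡⟨ ∑-cong ys (λ y → sym (∑-unique _≟ᴬ_ xs enumᴬ _ (fibre-unique y))) ⟩
    ∑ ys (λ y → ∑ xs (λ x → 𝟙 (p x ∧ ⌊ φ x ≟ᴮ y ⌋)))
      ≡⟨ ∑-swap ys xs (λ y x → 𝟙 (p x ∧ ⌊ φ x ≟ᴮ y ⌋)) ⟩
    ∑ xs (λ x → ∑ ys (λ y → 𝟙 (p x ∧ ⌊ φ x ≟ᴮ y ⌋)))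
      ≡⟨ ∑-cong xs (λ x → one (p x) (φ x)) ⟩
    ∑ xs (𝟙 ∘ p) ∎
    where
    open ≡-Reasoning
    fibre-unique : ∀ y x x′ → p x ∧ ⌊ φ x ≟ᴮ y ⌋ ≡ true → p x′ ∧ ⌊ φ x′ ≟ᴮ y ⌋ ≡ true → x ≡ x′
    fibre-unique y x x′ h h′ with ∧-true h | ∧-true h′
    ... | px , φx≡y | px′ , φx′≡y = inj x x′ px px′ (trans (⌊⌋-true⁻ φx≡y) (sym (⌊⌋-true⁻ φx′≡y)))
    one : ∀ c b → ∑ ys (λ y → 𝟙 (c ∧ ⌊ b ≟ᴮ y ⌋)) ≡ 𝟙 c
    one true  b = enumᴮ b
    one false b = ∑-0 ys λ _ → refl

module _ {v n} (f : Fin v → Fin n) where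

  ∈-image⁺ : ∀ S x → lookup S x ≡ true → lookup (image f S) (f x) ≡ true
  ∈-image⁺ S x Sx = trans (Vec.lookup∘tabulate _ (f x))
    (any-true⁺ _ (∈-allFin x) (cong₂ _∧_ Sx (⌊⌋-true⁺ (f x Fin.≟ f x) refl)))

  ∈-image⁻ : ∀ S y → lookup (image f S) y ≡ true → ∃ λ x → lookup S x ≡ true × f x ≡ y
  ∈-image⁻ S y h with any-true⁻ _ (allFin v) (trans (sym (Vec.lookup∘tabulate _ y)) h)
  ... | x , hx with ∧-true hx
  ...   | Sx , fx≡y = x , Sx , ⌊⌋-true⁻ fx≡y

  image-mono : ∀ S e → (∀ x → lookup S x ≡ true → lookup e x ≡ true) →
    ∀ y → lookup (image f S) y ≡ true → lookup (image f e) y ≡ true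
  image-mono S e S⊆e y h with ∈-image⁻ S y h
  ... | x , Sx , refl = ∈-image⁺ e x (S⊆e x Sx)

  module _ (f-inj : Injective _≡_ _≡_ f) where

    ∣image∣ : ∀ S → ∣ image f S ∣ ≡ ∣ S ∣
    ∣image∣ S = begin
      ∣ image f S ∣                              ≡⟨ ∣S∣≡∑ (image f S) ⟩
      ∑ (allFin n) (𝟙 ∘ lookup (image f S))      ≡⟨ ∑-cong (allFin n) (λ y → cong 𝟙 (Vec.lookup∘tabulate _ y)) ⟩
      ∑ (allFin n) (λ y → 𝟙 (any (λ x → lookup S x ∧ ⌊ f x Fin.≟ y ⌋) (allFin v)))
        ≡⟨ ∑-image Fin._≟_ Fin._≟_ (allFin v) (allFin n) (enumerates-allFin v) (enumerates-allFin n) f (lookup S) (λ _ _ _ _ → f-inj) ⟩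
      ∑ (allFin v) (𝟙 ∘ lookup S)                ≡⟨ ∣S∣≡∑ S ⟨
      ∣ S ∣                                      ∎
      where open ≡-Reasoning

    image-reflects : ∀ S S′ → image f S ≡ image f S′ → ∀ x → lookup S x ≡ true → lookup S′ x ≡ true
    image-reflects S S′ eq x Sx with ∈-image⁻ S′ (f x) (subst (λ e → lookup e (f x) ≡ true) eq (∈-image⁺ S x Sx))
    ... | x′ , S′x′ , fx′≡fx = subst (λ z → lookup S′ z ≡ true) (f-inj fx′≡fx) S′x′

-- Random hypergraphs

-- A set of subsets of an n-set, stored as a binary tree so that one can recurse on n.
Family : ℕ → Set
Family zero    = Bool
Family (suc n) = Family n × Family n

has : ∀ {n} → Family n → Subset n → Bool
has t       []          = t
has (l , r) (true  ∷ S) = has l S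
has (l , r) (false ∷ S) = has r S

-- Inclusion of `E` in the family, computed along the tree so that its indicator factors over the
-- two subtrees.
covers : ∀ {n} → Hypergraph n → Family n → Bool
covers {zero}  E t       = not (E []) ∨ t
covers {suc n} E (l , r) = covers (E ∘ (true ∷_)) l ∧ covers (E ∘ (false ∷_)) r

covers⁺ : ∀ {n} (E : Hypergraph n) t → (∀ S → E S ≡ true → has t S ≡ true) → covers E t ≡ true
covers⁺ {zero} E t E⊆t with E [] | E⊆t []
... | true  | h = h refl
... | false | _ = refl
covers⁺ {suc n} E (l , r) E⊆t = cong₂ _∧_
  (covers⁺ (E ∘ (true ∷_)) l (E⊆t ∘ (true ∷_))) (covers⁺ (E ∘ (false ∷_)) r (E⊆t ∘ (false ∷_)))

covers⁻ : ∀ {n} (E : Hypergraph n) t → covers E t ≡ true → ∀ S → E S ≡ true → has t S ≡ true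
covers⁻ {zero} E t h [] ES rewrite ES = h
covers⁻ {suc n} E (l , r) h (true  ∷ S) = covers⁻ (E ∘ (true ∷_)) l (proj₁ (∧-true h)) S
covers⁻ {suc n} E (l , r) h (false ∷ S) = covers⁻ (E ∘ (false ∷_)) r (proj₂ (∧-true h)) S

-- Expectation when each set is present independently with probability 1/(1+ρ),
-- scaled by (1+ρ)^(2^n) to stay in ℕ.
module _ (ρ : ℕ) where

  𝔼 : ∀ n → (Family n → ℕ) → ℕ
  𝔼 zero    f = f true + ρ * f false
  𝔼 (suc n) f = 𝔼 n λ l → 𝔼 n λ r → f (l , r)

  total : ℕ → ℕ
  total n = 𝔼 n λ _ → 1

  𝔼-cong : ∀ n {f g} → (∀ t → f t ≡ g t) → 𝔼 n f ≡ 𝔼 n g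
  𝔼-cong zero    f≗g = cong₂ (λ x y → x + ρ * y) (f≗g true) (f≗g false)
  𝔼-cong (suc n) f≗g = 𝔼-cong n λ l → 𝔼-cong n λ r → f≗g (l , r)

  𝔼-+ : ∀ n f g → 𝔼 n (λ t → f t + g t) ≡ 𝔼 n f + 𝔼 n g
  𝔼-+ zero f g = lem ρ (f true) (g true) (f false) (g false)
    where
    lem : ∀ ρ a b c d → a + b + ρ * (c + d) ≡ a + ρ * c + (b + ρ * d)
    lem = solve-∀
  𝔼-+ (suc n) f g = trans (𝔼-cong n λ l → 𝔼-+ n (λ r → f (l , r)) (λ r → g (l , r))) (𝔼-+ n _ _)

  𝔼-*ˡ : ∀ n c f → 𝔼 n (λ t → c * f t) ≡ c * 𝔼 n f
  𝔼-*ˡ zero c f = lem ρ c (f true) (f false)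
    where
    lem : ∀ ρ c a b → c * a + ρ * (c * b) ≡ c * (a + ρ * b)
    lem = solve-∀
  𝔼-*ˡ (suc n) c f = trans (𝔼-cong n λ l → 𝔼-*ˡ n c (λ r → f (l , r))) (𝔼-*ˡ n c _)

  𝔼-const : ∀ n c → 𝔼 n (λ _ → c) ≡ c * total n
  𝔼-const n c = trans (𝔼-cong n λ _ → sym (*-identityʳ c)) (𝔼-*ˡ n c _)

  -- Independence: the two subtrees record the outcomes for disjoint collections of sets.
  𝔼-product : ∀ n (f g : Family n → ℕ) → 𝔼 n (λ l → 𝔼 n λ r → f l * g r) ≡ 𝔼 n f * 𝔼 n g
  𝔼-product n f g = begin
    𝔼 n (λ l → 𝔼 n λ r → f l * g r)   ≡⟨ 𝔼-cong n (λ l → 𝔼-*ˡ n (f l) g) ⟩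
    𝔼 n (λ l → f l * 𝔼 n g)           ≡⟨ 𝔼-cong n (λ l → *-comm (f l) (𝔼 n g)) ⟩
    𝔼 n (λ l → 𝔼 n g * f l)           ≡⟨ 𝔼-*ˡ n (𝔼 n g) f ⟩
    𝔼 n g * 𝔼 n f                     ≡⟨ *-comm (𝔼 n g) (𝔼 n f) ⟩
    𝔼 n f * 𝔼 n g                     ∎
    where open ≡-Reasoning

  𝔼-∑ : ∀ n (xs : List A) (f : A → Family n → ℕ) →
    𝔼 n (λ t → ∑ xs λ x → f x t) ≡ ∑ xs (λ x → 𝔼 n (f x))
  𝔼-∑ n []       f = 𝔼-const n 0
  𝔼-∑ n (x ∷ xs) f = trans (𝔼-+ n (f x) _) (cong (𝔼 n (f x) +_) (𝔼-∑ n xs f))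

  total>0 : ∀ n → 0 < total n
  total>0 zero    = z<s
  total>0 (suc n) = subst (0 <_) (sym (𝔼-const n (total n))) (*-mono-< (total>0 n) (total>0 n))

  -- The averaging argument. A tree is found by fixing first its left and then its right subtree,
  -- each by induction.
  𝔼-witness : ∀ n {f g} → 𝔼 n f < 𝔼 n g → ∃ λ t → f t < g t
  𝔼-witness zero {f} {g} f<g with f true <? g true | f false <? g false
  ... | yes h | _     = true , h
  ... | no _  | yes h = false , h
  ... | no ≮₁ | no ≮₂ =
    contradiction f<g (≤⇒≯ (+-mono-≤ (≮⇒≥ ≮₁) (*-monoʳ-≤ ρ (≮⇒≥ ≮₂))))
  𝔼-witness (suc n) f<g with 𝔼-witness n f<g
  ... | l , f<g′ with 𝔼-witness n f<g′
  ...   | r , h = (l , r) , h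

  -- The members of `E` are present independently, each with probability `1 / suc ρ`. The power is
  -- moved to the left to avoid division.
  𝔼-covers : ∀ n (E : Hypergraph n) → 𝔼 n (𝟙 ∘ covers E) * suc ρ ^ size E ≡ total n
  𝔼-covers zero E with E []
  ... | true  = lem ρ
    where
    lem : ∀ ρ → (1 + ρ * 0) * (suc ρ * 1) ≡ 1 + ρ * 1
    lem = solve-∀
  ... | false = *-identityʳ _
  𝔼-covers (suc n) E = begin
    𝔼 n (λ l → 𝔼 n λ r → 𝟙 (covers E₁ l ∧ covers E₀ r)) * q ^ size E
      ≡⟨ cong₂ _*_ (𝔼-cong n λ l → 𝔼-cong n λ r → 𝟙-∧ (covers E₁ l) (covers E₀ r)) (cong (q ^_) (∑-allSubsets n (𝟙 ∘ E))) ⟩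
    𝔼 n (λ l → 𝔼 n λ r → 𝟙 (covers E₁ l) * 𝟙 (covers E₀ r)) * q ^ (size E₁ + size E₀)
      ≡⟨ cong₂ _*_ (𝔼-product n (𝟙 ∘ covers E₁) (𝟙 ∘ covers E₀)) (^-distribˡ-+-* q (size E₁) (size E₀)) ⟩
    𝔼 n (𝟙 ∘ covers E₁) * 𝔼 n (𝟙 ∘ covers E₀) * (q ^ size E₁ * q ^ size E₀)
      ≡⟨ lem (𝔼 n (𝟙 ∘ covers E₁)) (𝔼 n (𝟙 ∘ covers E₀)) (q ^ size E₁) (q ^ size E₀) ⟩
    𝔼 n (𝟙 ∘ covers E₁) * q ^ size E₁ * (𝔼 n (𝟙 ∘ covers E₀) * q ^ size E₀)
      ≡⟨ cong₂ _*_ (𝔼-covers n E₁) (𝔼-covers n E₀) ⟩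
    total n * total n
      ≡⟨ 𝔼-const n (total n) ⟨
    total (suc n) ∎
    where
    open ≡-Reasoning
    q = suc ρ
    E₁ = E ∘ (true ∷_)
    E₀ = E ∘ (false ∷_)
    lem : ∀ a b c d → a * b * (c * d) ≡ a * c * (b * d)
    lem = solve-∀

-- Faces and cliques

_⊑_ : ∀ {v} → Subset v → Subset v → Bool
[]      ⊑ []      = true
(s ∷ S) ⊑ (x ∷ K) = (not s ∨ x) ∧ (S ⊑ K)

⊑⁺ : ∀ {v} (S K : Subset v) → (∀ x → lookup S x ≡ true → lookup K x ≡ true) → S ⊑ K ≡ true
⊑⁺ [] [] _ = refl
⊑⁺ (true  ∷ S) (x ∷ K) S⊆K = cong₂ _∧_ (S⊆K zero refl) (⊑⁺ S K (S⊆K ∘ suc))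
⊑⁺ (false ∷ S) (x ∷ K) S⊆K = ⊑⁺ S K (S⊆K ∘ suc)

⊑⁻ : ∀ {v} (S K : Subset v) → S ⊑ K ≡ true → ∀ x → lookup S x ≡ true → lookup K x ≡ true
⊑⁻ (true ∷ S) (x ∷ K) h zero refl = proj₁ (∧-true h)
⊑⁻ (s ∷ S) (x ∷ K) h (suc y) = ⊑⁻ S K (proj₂ (∧-true {not s ∨ x} h)) y

faces : ∀ {v} → ℕ → Subset v → Hypergraph v
faces a K S = (∣ S ∣ ≡ᵇ a) ∧ (S ⊑ K)

-- Splitting by the first vertex gives Pascal's rule; `_⊑_` recurses on vectors so that this split
-- computes.
size-faces : ∀ {v} a (K : Subset v) → size (faces a K) ≡ ∣ K ∣ C a
size-faces zero [] = refl
size-faces (suc a) [] = refl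
size-faces {suc v} a (false ∷ K) = trans (∑-allSubsets v _) (cong₂ _+_
  (∑-0 (allSubsets v) λ S → cong 𝟙 (Bool.∧-zeroʳ (suc ∣ S ∣ ≡ᵇ a)))
  (size-faces a K))
size-faces {suc v} zero (true ∷ K) = trans (∑-allSubsets v _) (cong₂ _+_
  (∑-0 (allSubsets v) λ S → refl)
  (trans (size-faces zero K) (trans (nC0≡1 ∣ K ∣) (sym (nC0≡1 (suc ∣ K ∣))))))
size-faces {suc v} (suc a) (true ∷ K) = trans (∑-allSubsets v _) (trans
  (cong₂ _+_ (size-faces a K) (size-faces (suc a) K))
  (nCk+nC[k+1]≡[n+1]C[k+1] ∣ K ∣ a))

size-uniform : ∀ n k → ∑ (allSubsets n) (λ K → 𝟙 (∣ K ∣ ≡ᵇ k)) ≡ n C k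
size-uniform zero zero = refl
size-uniform zero (suc k) = refl
size-uniform (suc n) zero = trans (∑-allSubsets n _) (cong₂ _+_
  (∑-0 (allSubsets n) λ S → refl)
  (trans (size-uniform n zero) (trans (nC0≡1 n) (sym (nC0≡1 (suc n))))))
size-uniform (suc n) (suc k) = trans (∑-allSubsets n _) (trans
  (cong₂ _+_ (size-uniform n k) (size-uniform n (suc k)))
  (nCk+nC[k+1]≡[n+1]C[k+1] n k))

cliques : ∀ {n} → ℕ → ℕ → Family n → Hypergraph n
cliques a k t K = (∣ K ∣ ≡ᵇ k) ∧ covers (faces a K) t

-- Linearity of expectation over the `k`-sets, each of which needs its `k C a` faces to be present.
𝔼-cliques : ∀ ρ n a k →
  𝔼 ρ n (λ t → size (cliques a k t)) * suc ρ ^ (k C a) ≡ (n C k) * total ρ n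
𝔼-cliques ρ n a k = begin
  𝔼 ρ n (λ t → size (cliques a k t)) * y
    ≡⟨ cong (_* y) (𝔼-∑ ρ n (allSubsets n) (λ K t → 𝟙 (cliques a k t K))) ⟩
  ∑ (allSubsets n) (λ K → 𝔼 ρ n λ t → 𝟙 (cliques a k t K)) * y
    ≡⟨ ∑-*ʳ (allSubsets n) _ y ⟨
  ∑ (allSubsets n) (λ K → 𝔼 ρ n (λ t → 𝟙 (cliques a k t K)) * y)
    ≡⟨ ∑-cong (allSubsets n) each ⟩
  ∑ (allSubsets n) (λ K → 𝟙 (∣ K ∣ ≡ᵇ k) * total ρ n)
    ≡⟨ ∑-*ʳ (allSubsets n) _ (total ρ n) ⟩
  ∑ (allSubsets n) (λ K → 𝟙 (∣ K ∣ ≡ᵇ k)) * total ρ n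
    ≡⟨ cong (_* total ρ n) (size-uniform n k) ⟩
  (n C k) * total ρ n ∎
  where
  open ≡-Reasoning
  y = suc ρ ^ (k C a)
  each : ∀ K → 𝔼 ρ n (λ t → 𝟙 (cliques a k t K)) * y ≡ 𝟙 (∣ K ∣ ≡ᵇ k) * total ρ n
  each K with ∣ K ∣ ≡ᵇ k in eq
  ... | false = cong (_* y) (𝔼-const ρ n 0)
  ... | true  = begin
    𝔼 ρ n (𝟙 ∘ covers (faces a K)) * y
      ≡⟨ cong (λ s → 𝔼 ρ n (𝟙 ∘ covers (faces a K)) * suc ρ ^ s) (trans (size-faces a K) (cong (_C a) ∣K∣≡k)) ⟨
    𝔼 ρ n (𝟙 ∘ covers (faces a K)) * suc ρ ^ size (faces a K)
      ≡⟨ 𝔼-covers ρ n (faces a K) ⟩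
    total ρ n
      ≡⟨ +-identityʳ _ ⟨
    1 * total ρ n ∎
    where
    ∣K∣≡k : ∣ K ∣ ≡ k
    ∣K∣≡k = ≡ᵇ⇒≡ ∣ K ∣ k (≡true⇒T eq)

-- The vertices outside W are all sent to y₀, so that there are only n^∣W∣ maps.
mapsOn : ∀ {v n} → Fin n → Subset v → List (Vec (Fin n) v)
mapsOn y₀ []          = [] ∷ []
mapsOn y₀ (true  ∷ W) = cartesianProductWith _∷_ (allFin _) (mapsOn y₀ W)
mapsOn y₀ (false ∷ W) = map (y₀ ∷_) (mapsOn y₀ W)

length-mapsOn : ∀ {v n} (y₀ : Fin n) (W : Subset v) → length (mapsOn y₀ W) ≡ n ^ ∣ W ∣
length-mapsOn y₀ [] = refl
length-mapsOn {n = n} y₀ (true ∷ W) =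
  trans (go (allFin n)) (cong₂ _*_ (List.length-tabulate {n = n} id) (length-mapsOn y₀ W))
  where
  gs = mapsOn y₀ W
  go : ∀ ys → length (cartesianProductWith Vec._∷_ ys gs) ≡ length ys * length gs
  go []       = refl
  go (y ∷ ys) = trans (List.length-++ (map (y Vec.∷_) gs)) (cong₂ _+_ (List.length-map (y Vec.∷_) gs) (go ys))
length-mapsOn y₀ (false ∷ W) = trans (List.length-map (y₀ ∷_) (mapsOn y₀ W)) (length-mapsOn y₀ W)

mapsOn-complete : ∀ {v n} (y₀ : Fin n) (W : Subset v) (f : Fin v → Fin n) →
  ∃ λ g → g ∈ˡ mapsOn y₀ W × (∀ x → lookup W x ≡ true → lookup g x ≡ f x)
mapsOn-complete y₀ [] f = [] , here refl , λ ()
mapsOn-complete y₀ (true ∷ W) f with mapsOn-complete y₀ W (f ∘ suc)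
... | g , g∈ , g≗f = f zero ∷ g , ∈-cartesianProductWith⁺ _∷_ (∈-allFin (f zero)) g∈
                   , λ { zero _ → refl ; (suc x) → g≗f x }
mapsOn-complete y₀ (false ∷ W) f with mapsOn-complete y₀ W (f ∘ suc)
... | g , g∈ , g≗f = y₀ ∷ g , ∈-map⁺ _ g∈ , λ { (suc x) → g≗f x }

imageᴴ : ∀ {v n} → (Fin v → Fin n) → Hypergraph v → Hypergraph n
imageᴴ {v} f F S′ = any (λ S → F S ∧ ⌊ image f S ≟ˢ S′ ⌋) (allSubsets v)

module _ {v n} (f : Fin v → Fin n) (F : Hypergraph v) where

  imageᴴ⁻ : ∀ S′ → imageᴴ f F S′ ≡ true → ∃ λ S → F S ≡ true × image f S ≡ S′
  imageᴴ⁻ S′ h with any-true⁻ (λ S → F S ∧ ⌊ image f S ≟ˢ S′ ⌋) (allSubsets v) h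
  ... | S , hS with ∧-true hS
  ...   | FS , eq = S , FS , ⌊⌋-true⁻ eq

  size-imageᴴ : Injective _≡_ _≡_ f → size (imageᴴ f F) ≡ size F
  size-imageᴴ f-inj = ∑-image _≟ˢ_ _≟ˢ_ (allSubsets v) (allSubsets n)
    (enumerates-allSubsets v) (enumerates-allSubsets n) (image f) F
    λ S S′ _ _ eq → lookup-ext λ x →
      Bool-ext (image-reflects f f-inj S S′ eq x) (image-reflects f f-inj S′ S (sym eq) x)
    where
    Bool-ext : ∀ {a b} → (a ≡ true → b ≡ true) → (b ≡ true → a ≡ true) → a ≡ b
    Bool-ext {true}  {b}     h _ = sym (h refl)
    Bool-ext {false} {false} _ _ = refl
    Bool-ext {false} {true}  _ h = h refl
    lookup-ext : ∀ {n} {S S′ : Subset n} → (∀ x → lookup S x ≡ lookup S′ x) → S ≡ S′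
    lookup-ext {S = S} {S′} h =
      trans (sym (Vec.tabulate∘lookup S)) (trans (Vec.tabulate-cong h) (Vec.tabulate∘lookup S′))

-- Maps that are not injective may shrink F; those with fewer than size F images are not counted.
copies : ∀ {v n} → Fin n → Subset v → Hypergraph v → Family n → ℕ
copies y₀ W F t = ∑ (mapsOn y₀ W) λ g →
  𝟙 ((size F ≤ᵇ size (imageᴴ (lookup g) F)) ∧ covers (imageᴴ (lookup g) F) t)

-- Linearity over the `n ^ ∣ W ∣` listed maps. The size test ensures that each counted map needs at
-- least `size F` sets to be present.
𝔼-copies : ∀ ρ {v n} (y₀ : Fin n) (W : Subset v) F →
  𝔼 ρ n (copies y₀ W F) * suc ρ ^ size F ≤ n ^ ∣ W ∣ * total ρ n
𝔼-copies ρ {v} {n} y₀ W F = begin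
  𝔼 ρ n (copies y₀ W F) * y
    ≡⟨ cong (_* y) (𝔼-∑ ρ n (mapsOn y₀ W) _) ⟩
  ∑ (mapsOn y₀ W) (λ g → 𝔼 ρ n (λ t → 𝟙 ((size F ≤ᵇ size (E g)) ∧ covers (E g) t))) * y
    ≡⟨ ∑-*ʳ (mapsOn y₀ W) _ y ⟨
  ∑ (mapsOn y₀ W) (λ g → 𝔼 ρ n (λ t → 𝟙 ((size F ≤ᵇ size (E g)) ∧ covers (E g) t)) * y)
    ≤⟨ ∑-mono (mapsOn y₀ W) each ⟩
  ∑ (mapsOn y₀ W) (λ _ → total ρ n)
    ≡⟨ ∑-const (mapsOn y₀ W) (total ρ n) ⟩
  length (mapsOn y₀ W) * total ρ n
    ≡⟨ cong (_* total ρ n) (length-mapsOn y₀ W) ⟩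
  n ^ ∣ W ∣ * total ρ n ∎
  where
  open ≤-Reasoning
  y = suc ρ ^ size F
  E : Vec (Fin n) v → Hypergraph n
  E g = imageᴴ (lookup g) F
  each : ∀ g → 𝔼 ρ n (λ t → 𝟙 ((size F ≤ᵇ size (E g)) ∧ covers (E g) t)) * y ≤ total ρ n
  each g with size F ≤ᵇ size (E g) in eq
  ... | false = ≤-trans (≤-reflexive (cong (_* y) (𝔼-const ρ n 0))) z≤n
  ... | true  = begin
    𝔼 ρ n (𝟙 ∘ covers (E g)) * y
      ≤⟨ *-monoʳ-≤ (𝔼 ρ n (𝟙 ∘ covers (E g))) (^-monoʳ-≤ (suc ρ) (≤ᵇ⇒≤ (size F) _ (≡true⇒T eq))) ⟩
    𝔼 ρ n (𝟙 ∘ covers (E g)) * suc ρ ^ size (E g)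
      ≡⟨ 𝔼-covers ρ n (E g) ⟩
    total ρ n ∎

-- The listed map `g` agrees with `f` only on `W`, but all edges of `F` lie there, so both maps send
-- them to the same sets. Injectivity of `f` keeps these sets distinct, hence `g` passes the size
-- test.
copies>0 : ∀ {v n} (y₀ : Fin n) (W : Subset v) F t (f : Fin v → Fin n) → Injective _≡_ _≡_ f →
  (∀ S → F S ≡ true → S ⊑ W ≡ true) →
  (∀ S → F S ≡ true → has t (image f S) ≡ true) → 0 < copies y₀ W F t
copies>0 {v} y₀ W F t f f-inj F⊆W f[F]⊆t with mapsOn-complete y₀ W f
... | g , g∈ , g≗f = ≤-trans (≤-reflexive (sym (cong 𝟙 (cong₂ _∧_ size≤ covered)))) (≤∑ _ g∈)
  where
  image-agree : ∀ S → F S ≡ true → image (lookup g) S ≡ image f S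
  image-agree S FS = Vec.tabulate-cong λ y → any-cong (allFin _) λ x → agree y x
    where
    any-cong : ∀ {p q : Fin v → Bool} xs → (∀ x → p x ≡ q x) → any p xs ≡ any q xs
    any-cong []       h = refl
    any-cong (x ∷ xs) h = cong₂ _∨_ (h x) (any-cong xs h)
    agree : ∀ y x → lookup S x ∧ ⌊ lookup g x Fin.≟ y ⌋ ≡ lookup S x ∧ ⌊ f x Fin.≟ y ⌋
    agree y x with lookup S x in Sx
    ... | false = refl
    ... | true  = cong (λ z → ⌊ z Fin.≟ y ⌋) (g≗f x (⊑⁻ S W (F⊆W S FS) x Sx))
  covered : covers (imageᴴ (lookup g) F) t ≡ true
  covered = covers⁺ _ t λ S′ h → let S , FS , eq = imageᴴ⁻ (lookup g) F S′ h in
    subst (λ e → has t e ≡ true) (trans (sym (image-agree S FS)) eq) (f[F]⊆t S FS)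
  size-agree : size (imageᴴ f F) ≤ size (imageᴴ (lookup g) F)
  size-agree = ∑-mono (allSubsets _) λ S′ → 𝟙-mono λ h → let S , FS , eq = imageᴴ⁻ f F S′ h in
    any-true⁺ (λ S → F S ∧ ⌊ image (lookup g) S ≟ˢ S′ ⌋) (∈-allSubsets S)
      (cong₂ _∧_ FS (⌊⌋-true⁺ (_ ≟ˢ S′) (trans (image-agree S FS) eq)))
  size≤ : (size F ≤ᵇ size (imageᴴ (lookup g) F)) ≡ true
  size≤ = T⇒≡true (≤⇒≤ᵇ (≤-trans (≤-reflexive (sym (size-imageᴴ f F f-inj))) size-agree))

-- Averaging the single quantity `bad`, which combines the target number of cliques with a penalty
-- for copies, yields both conclusions for the same outcome.
first-moment : ∀ ρ {v n} (y₀ : Fin n) (W : Subset v) F a k s → k ≤ n →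
  size F ≡ k C a + s → 2 * n ^ ∣ W ∣ < suc ρ ^ s →
  ∃ λ t → copies y₀ W F t ≡ 0 × n C k ≤ 2 * suc ρ ^ (k C a) * size (cliques a k t)
first-moment ρ {n = n} y₀ W F a k s k≤n sizeF few =
  good (𝔼-witness ρ n {bad} {λ t → Y * cl t} bad<)
  where
  T′ = n C k
  M = total ρ n
  q = suc ρ
  y = q ^ (k C a)
  Y = 2 * y
  cl cp bad : Family n → ℕ
  cl t = size (cliques a k t)
  cp = copies y₀ W F
  bad t = T′ + Y * T′ * cp t
  P = 𝔼 ρ n cp

  -- After division by the total weight `M`, the mean number of copies is below `1 / Y`.
  YP<M : Y * P < M
  YP<M = *-cancelˡ-< (q ^ s) _ _ (begin-strict
    q ^ s * (Y * P)               ≡⟨ lem (q ^ s) y P ⟩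
    2 * (P * (y * q ^ s))         ≡⟨ cong (λ z → 2 * (P * z)) (trans (cong (q ^_) sizeF) (^-distribˡ-+-* q (k C a) s)) ⟨
    2 * (P * q ^ size F)          ≤⟨ *-monoʳ-≤ 2 (𝔼-copies ρ y₀ W F) ⟩
    2 * (n ^ ∣ W ∣ * M)           ≡⟨ *-assoc 2 (n ^ ∣ W ∣) M ⟨
    2 * n ^ ∣ W ∣ * M             <⟨ *-monoˡ-< M {{>-nonZero (total>0 ρ n)}} few ⟩
    q ^ s * M                     ∎)
    where
    open ≤-Reasoning
    lem : ∀ x y p → x * (2 * y * p) ≡ 2 * (p * (y * x))
    lem = solve-∀

  -- The mean of `Y * cl t` is exactly `2 T′`. The mean of `bad t` is `T′` plus a penalty of less
  -- than `T′`.
  bad< : 𝔼 ρ n bad < 𝔼 ρ n (λ t → Y * cl t)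
  bad< = begin-strict
    𝔼 ρ n bad                     ≡⟨ trans (𝔼-+ ρ n _ _) (cong₂ _+_ (𝔼-const ρ n T′) (𝔼-*ˡ ρ n (Y * T′) cp)) ⟩
    T′ * M + Y * T′ * P           ≡⟨ cong (T′ * M +_) (lem₁ Y T′ P) ⟩
    T′ * M + T′ * (Y * P)         <⟨ +-monoʳ-< (T′ * M) (*-monoʳ-< T′ {{>-nonZero (C>0 k≤n)}} YP<M) ⟩
    T′ * M + T′ * M               ≡⟨ cong (λ z → z + z) (𝔼-cliques ρ n a k) ⟨
    𝔼 ρ n cl * y + 𝔼 ρ n cl * y   ≡⟨ lem₂ (𝔼 ρ n cl) y ⟩
    Y * 𝔼 ρ n cl                  ≡⟨ 𝔼-*ˡ ρ n Y cl ⟨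
    𝔼 ρ n (λ t → Y * cl t)        ∎
    where
    open ≤-Reasoning
    lem₁ : ∀ Y T P → Y * T * P ≡ T * (Y * P)
    lem₁ = solve-∀
    lem₂ : ∀ e y → e * y + e * y ≡ 2 * y * e
    lem₂ = solve-∀

  cl≤T′ : ∀ t → cl t ≤ T′
  cl≤T′ t = ≤-trans (∑-mono (allSubsets n) λ K → 𝟙-mono (proj₁ ∘ ∧-true)) (≤-reflexive (size-uniform n k))

  -- A single copy already makes bad t at least Y * T′, which Y * cl t never exceeds.
  good : (∃ λ t → bad t < Y * cl t) → ∃ λ t → cp t ≡ 0 × T′ ≤ Y * cl t
  good (t , bad<) with cp t in eq
  ... | zero  = t , eq , ≤-trans (m≤m+n T′ _) (<⇒≤ bad<)
  ... | suc c = contradiction bad< (≤⇒≯ (begin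
    Y * cl t                ≤⟨ *-monoʳ-≤ Y (cl≤T′ t) ⟩
    Y * T′                  ≤⟨ m≤m*n (Y * T′) (suc c) ⟩
    Y * T′ * suc c          ≤⟨ m≤n+m _ T′ ⟩
    T′ + Y * T′ * suc c     ∎))
    where open ≤-Reasoning

-- Dense subhypergraphs of skeleta

restrict : ∀ {v} → Hypergraph v → Subset v → Hypergraph v
restrict G W e = G e ∧ (e ⊑ W)

degree≡∑ : ∀ {v} (F : Hypergraph v) w → degree F w ≡ ∑ (allSubsets v) (λ e → 𝟙 (F e ∧ lookup e w))
degree≡∑ F w = edgeCount≡size (λ e → F e ∧ lookup e w)

-- Replacing `F` by all edges of `G` inside `W` only raises degrees, so failure of the bound is a
-- property of `W` alone. It is decidable and there are finitely many `W`, so a search turns the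
-- negation into a witness.
dense-core : ∀ {v} (G : Hypergraph v) d → ¬ MinDegAllSubAtMost G d →
  ∃ λ W → Nonempty W × (∀ w → w ∈ W → d < degree (restrict G W) w)
dense-core {v} G d ¬sparse
  with anySubset? (λ W → nonempty? W ×-dec Fin.all? (λ w → (w ∈? W) →-dec (d <? degree (restrict G W) w)))
... | yes core = core
... | no ¬core = contradiction sparse ¬sparse
  where
  sparse : MinDegAllSubAtMost G d
  sparse W F F⊆G F⊆W nonempty
    with Fin.any? (λ w → (w ∈? W) ×-dec (degree F w ≤? d))
  ... | yes low = low
  ... | no ¬low = contradiction (W , nonempty , high) ¬core
    where
    deg-mono : ∀ w → degree F w ≤ degree (restrict G W) w
    deg-mono w = subst₂ _≤_ (sym (degree≡∑ F w)) (sym (degree≡∑ (restrict G W) w))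
      (∑-mono (allSubsets v) λ e → 𝟙-mono λ h → let Fe , ew = ∧-true h in
        cong₂ _∧_ (cong₂ _∧_ (F⊆G e Fe) (⊑⁺ e W λ x ex → Vec.[]=⇒lookup (F⊆W e Fe (Vec.lookup⇒[]= x e ex)))) ew)
    high : ∀ w → w ∈ W → d < degree (restrict G W) w
    high w w∈W = ≰⇒> λ deg≤d → ¬low (w , w∈W , ≤-trans (deg-mono w) deg≤d)

-- Double count of incidences. Vertices outside `W` may have positive degree too, hence only an
-- inequality.
handshake : ∀ {v} (F : Hypergraph v) W a d → (∀ e → F e ≡ true → ∣ e ∣ ≡ a) →
  (∀ w → w ∈ W → d ≤ degree F w) → d * ∣ W ∣ ≤ a * size F
handshake {v} F W a d uniform d≤deg = begin
  d * ∣ W ∣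
    ≡⟨ trans (*-comm d ∣ W ∣) (cong (_* d) (∣S∣≡∑ W)) ⟩
  ∑ (allFin v) (𝟙 ∘ lookup W) * d
    ≡⟨ ∑-*ʳ (allFin v) (𝟙 ∘ lookup W) d ⟨
  ∑ (allFin v) (λ w → 𝟙 (lookup W w) * d)
    ≤⟨ ∑-mono (allFin v) low ⟩
  ∑ (allFin v) (λ w → ∑ (allSubsets v) λ e → 𝟙 (F e ∧ lookup e w))
    ≡⟨ ∑-swap (allFin v) (allSubsets v) (λ w e → 𝟙 (F e ∧ lookup e w)) ⟩
  ∑ (allSubsets v) (λ e → ∑ (allFin v) λ w → 𝟙 (F e ∧ lookup e w))
    ≡⟨ ∑-cong (allSubsets v) count ⟩
  ∑ (allSubsets v) (λ e → 𝟙 (F e) * a)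
    ≡⟨ trans (∑-*ʳ (allSubsets v) (𝟙 ∘ F) a) (*-comm (size F) a) ⟩
  a * size F ∎
  where
  open ≤-Reasoning
  low : ∀ w → 𝟙 (lookup W w) * d ≤ ∑ (allSubsets v) (λ e → 𝟙 (F e ∧ lookup e w))
  low w with lookup W w in eq
  ... | false = z≤n
  ... | true  = subst₂ _≤_ (sym (*-identityˡ d)) (degree≡∑ F w) (d≤deg w (Vec.lookup⇒[]= w W eq))
  count : ∀ e → ∑ (allFin v) (λ w → 𝟙 (F e ∧ lookup e w)) ≡ 𝟙 (F e) * a
  count e with F e in eq
  ... | false = ∑-0 (allFin v) λ _ → refl
  ... | true  = trans (sym (∣S∣≡∑ e)) (trans (uniform e eq) (sym (+-identityʳ a)))

module _ {v} (i : ℕ) (H : Hypergraph v) where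

  skeleton-uniform : ∀ S → skeleton i H S ≡ true → ∣ S ∣ ≡ suc i
  skeleton-uniform S h = ⌊⌋-true⁻ (proj₁ (∧-true {⌊ ∣ S ∣ Data.Nat.≟ suc i ⌋} h))

  skeleton⊆edge : ∀ S → skeleton i H S ≡ true →
    ∃ λ e → H e ≡ true × (∀ x → lookup S x ≡ true → lookup e x ≡ true)
  skeleton⊆edge S h with any-true⁻ (λ e → H e ∧ subsetB S e) (allSubsets v) (proj₂ (∧-true {⌊ ∣ S ∣ Data.Nat.≟ suc i ⌋} h))
  ... | e , he with ∧-true he
  ...   | He , S⊆e = e , He , subsetB⇒⊆ S e S⊆e

  -- One vertex of `W` already lies in `d` edges, which exceeds `k C suc i`; at most `k` vertices
  -- leave no room for so many `suc i`-sets.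
  core-large : ∀ W k d → Nonempty W → k C suc i < d →
    (∀ w → w ∈ W → d ≤ degree (restrict (skeleton i H) W) w) →
    k C suc i ≤ size (restrict (skeleton i H) W) × k < ∣ W ∣
  core-large W k d (w , w∈W) c<d d≤deg =
    <⇒≤ (<-≤-trans c<d d≤e) , ≰⇒> λ ∣W∣≤k → <-irrefl refl (begin-strict
      k C suc i                  <⟨ <-≤-trans c<d d≤e ⟩
      size F                     ≤⟨ ∑-mono (allSubsets v) (λ S → 𝟙-mono (face S)) ⟩
      size (faces (suc i) W)     ≡⟨ size-faces (suc i) W ⟩
      ∣ W ∣ C suc i              ≤⟨ C-monoˡ (suc i) ∣W∣≤k ⟩
      k C suc i                  ∎)
    where
    open ≤-Reasoning
    F = restrict (skeleton i H) W
    d≤e : d ≤ size F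
    d≤e = ≤-trans (d≤deg w w∈W) (≤-trans (≤-reflexive (degree≡∑ F w))
      (∑-mono (allSubsets v) λ e → 𝟙-mono (proj₁ ∘ ∧-true)))
    face : ∀ S → F S ≡ true → faces (suc i) W S ≡ true
    face S FS = let sk , S⊑W = ∧-true FS in
      cong₂ _∧_ (T⇒≡true (≡⇒≡ᵇ ∣ S ∣ (suc i) (skeleton-uniform S sk))) S⊑W

  -- `S` lies in an edge `e` of `H`, so its image is a face of the clique `image f e`.
  copy-in-cliques : ∀ {n} (f : Fin v → Fin n) k t → Injective _≡_ _≡_ f →
    (∀ e → H e ≡ true → cliques (suc i) k t (image f e) ≡ true) →
    ∀ S → skeleton i H S ≡ true → has t (image f S) ≡ true
  copy-in-cliques f k t f-inj f[H]⊆ S sk with skeleton⊆edge S sk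
  ... | e , He , S⊆e = covers⁻ (faces (suc i) (image f e)) t (proj₂ (∧-true {∣ image f e ∣ ≡ᵇ k} (f[H]⊆ e He))) (image f S)
    (cong₂ _∧_ (T⇒≡true (≡⇒≡ᵇ ∣ image f S ∣ (suc i) (trans (∣image∣ f f-inj S) (skeleton-uniform S sk))))
      (⊑⁺ (image f S) (image f e) (image-mono f S e S⊆e)))

-- The hypergraph of cliques

module _ (k d i : ℕ) (i<k : i < k) (c<d : k C suc i < d)
         {v : ℕ} (H : Hypergraph v) (W : Subset v) (nonempty : Nonempty W)
         (d≤deg : ∀ w → w ∈ W → d ≤ degree (restrict (skeleton i H) W) w) where

  private
    c = k C suc i
    F = restrict (skeleton i H) W

    F-large : c ≤ size F × k < ∣ W ∣
    F-large = core-large i H W k d nonempty c<d d≤deg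

    s = size F ∸ c

    sizeF : size F ≡ c + s
    sizeF = sym (m+[n∸m]≡n (proj₁ F-large))

    gap : ∣ W ∣ * (c * d) < 3 ^ k * s
    gap = exponent-gap k i d ∣ W ∣ s i<k (proj₂ F-large) c<d
      (subst (λ e → d * ∣ W ∣ ≤ suc i * e) sizeF
        (handshake F W (suc i) d (λ e Fe → skeleton-uniform i H e (proj₁ (∧-true Fe))) d≤deg))

  H-free : ∀ {n} (y₀ : Fin n) t → copies y₀ W F t ≡ 0 → ¬ ContainsCopy (cliques (suc i) k t) H
  H-free y₀ t no-copies (f , f-inj , f[H]⊆G) = contradiction no-copies (m<n⇒n≢0
    (copies>0 y₀ W F t f f-inj (λ S FS → proj₂ (∧-true {skeleton i H S} FS))
      (λ S FS → copy-in-cliques i H f k t f-inj f[H]⊆G S (proj₁ (∧-true FS)))))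

  cliques-extremal : ∀ ρ n → 2 ^ (c * d) < n → k ≤ n → n ^ (3 ^ k) ≤ suc ρ ^ (c * d) →
    ∃ λ m → ExAtLeast k n H m × n C k ≤ 2 * suc ρ ^ c * m
  -- The lower bound on `n` excludes `n = 0`, so the vertex `zero` can serve as the default value in
  -- `mapsOn`.
  cliques-extremal ρ n@(suc _) n-large k≤n n^≤q^ =
    let t , no-copies , many = first-moment ρ zero W F (suc i) k s k≤n sizeF
          (few-copies {n} {suc ρ} {c * d} {3 ^ k} {∣ W ∣} {s} n^≤q^ n-large gap)
        G = cliques (suc i) k t
    in size G , (G , (λ K h → ≡ᵇ⇒≡ ∣ K ∣ k (≡true⇒T (proj₁ (∧-true h)))) , H-free zero t no-copies
         , ≤-reflexive (sym (edgeCount≡size G))) , many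

-- In the threshold for `n`, `k + k` serves the lower bound on `n C k`, and the power of 2 serves
-- `few-copies`.
extremal : ∀ k d i → i < k → k C suc i < d → ∀ {v} (H : Hypergraph v) → SkelDegGE H i d →
  ∀ n → k + k + suc (2 ^ ((k C suc i) * d)) ≤ n →
  ∃ λ m → ExAtLeast k n H m ×
    n ^ (k * d) ≤ (2 ^ k * k ! * 2 * 2 ^ (3 ^ k) * m) ^ d * n ^ (3 ^ k)
extremal k (suc d′) i i<k c<d H dense n n-large =
  let d = suc d′
      c = k C suc i
      2k≤n = ≤-trans (m≤m+n (k + k) (suc (2 ^ (c * d)))) n-large
      2^<n = ≤-trans (m≤n+m (suc (2 ^ (c * d))) (k + k)) n-large
      -- The density hypothesis is used at `d − 1`: degrees above `d − 1` are at least `d`.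
      W , nonempty , d≤deg = dense-core (skeleton i H) d′ (dense d′ ≤-refl)
      ρ , n^≤q^ , q^≤ = ceil-root (c * d) {{m*n≢0 c d {{>-nonZero (C>0 i<k)}}}} (n ^ (3 ^ k))
        (m^n>0 n {{>-nonZero (≤-<-trans z≤n 2^<n)}} (3 ^ k))
      m , ex , many = cliques-extremal k d i i<k c<d H W nonempty d≤deg ρ n 2^<n
        (≤-trans (m≤m+n k k) 2k≤n) n^≤q^
  in m , ex , many-edges {n} {k} {c} {d} {suc ρ} {2 ^ k * k !} {n C k} {m} {3 ^ k}
       (n^k≤2^k*k!*nCk {n} {k} 2k≤n) many q^≤ (≤-trans (m≤m+n c (k * c)) ([1+k]*kCi≤3^k k (suc i)))

-- Taking `d`-th roots, the final inequality reads `m ≥ n^(k − 3^k / d) / B`. The constant `B` is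
-- fixed before `d`, `i` and `H`, so it depends on `k` alone, while the threshold `N` may depend on
-- all of them.
theorem3p2 : (k : ℕ) → Σ ℕ λ B → 1 ≤ B ×
    ((d i : ℕ) → 1 ≤ i → i < k → k C (i + 1) < d →
    (v : ℕ) (H : Hypergraph v) → Uniform k H → SkelDegGE H i d →
    Σ ℕ λ N → (n : ℕ) → N ≤ n →
    Σ ℕ λ m → ExAtLeast k n H m × n ^ (k * d) ≤ (B * m) ^ d * n ^ (3 ^ k))
theorem3p2 k = 2 ^ k * k ! * 2 * 2 ^ (3 ^ k) , B>0 , λ d i _ i<k c<d v H _ dense →
  k + k + suc (2 ^ ((k C suc i) * d)) ,
  extremal k d i i<k (subst (λ a → k C a < d) (+-comm i 1) c<d) H dense
  where
  B>0 : 1 ≤ 2 ^ k * k ! * 2 * 2 ^ (3 ^ k)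
  B>0 = *-mono-≤ (*-mono-≤ (*-mono-≤ (m^n>0 2 k) (1≤n! k)) (s≤s z≤n)) (m^n>0 2 (3 ^ k))
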